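{- For each positive integer $n$ there exists a cubic graph $H$ with $l(H)=n$.
   Context: Graphs may contain parallel edges but no loops. A graph is Class I if its chromatic index equals its maximum degree. For (not necessarily distinct) edge sets $N_1,\dots,N_t\subseteq E(H)$, $H+N_1+\dots+N_t$ denotes the multigraph obtained from $H$ by adding to every edge $e$ of $H$ a number of parallel edges equal to the number of indices $i$ with $e\in N_i$. The parameter $l(H)$ is the minimum integer $k\ge 0$ for which there exist perfect matchings $M_1,\dots,M_k$ of $H$ (repetitions allowed) such that $H+M_1+\dots+M_k$ is Class I; $l(H)=+\infty$ if no such $k$ exists. -}

module Defs where

open import Data.Bool using (Bool; T)
open import Data.Bool.Properties using (T?)
open import Data.Fin using (Fin; zero; suc)
open import Data.Fin.Properties using (+↔⊎; inj⇒≟)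
open import Data.List using (List; length; filter; map; allFin)
open import Data.List.Extrema.Nat using (max)
open import Data.Nat using (ℕ; zero; suc; _≤_)
open import Data.Product using (Σ; ∃; _×_; _,_; proj₁; proj₂)
open import Data.Product.Function.Dependent.Propositional using (Σ-↔)
open import Data.Sum using (_⊎_; inj₁; inj₂)
open import Data.Sum.Function.Propositional using (_⊎-↔_)
open import Function using (_∘_)
open import Function.Bundles using (_↔_; mk↔ₛ′; Inverse)
open import Function.Construct.Composition using (_↔-∘_)
open import Function.Properties.Inverse using (↔-refl; ↔-sym; ↔⇒↣)
open import Relation.Binary.Definitions using (DecidableEquality)
open import Relation.Binary.PropositionalEquality using (_≡_; _≢_; refl)
open import Relation.Nullary using (¬_; Dec)
open import Relation.Nullary.Construct.Add.Supremum using (_⁺; ⊤⁺; [_])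
open import Relation.Nullary.Decidable using (_⊎-dec_)

Finite : Set → Set
Finite A = ∃ λ n → A ↔ Fin n

elements : ∀ {A} → Finite A → List A
elements (n , A↔Fin) = map (Inverse.from A↔Fin) (allFin n)

finite⇒≟ : ∀ {A} → Finite A → DecidableEquality A
finite⇒≟ (_ , A↔Fin) = inj⇒≟ (↔⇒↣ A↔Fin)

private
  Σ-Fin-suc : ∀ {n} (f : Fin (suc n) → ℕ) →
              Σ (Fin (suc n)) (Fin ∘ f) ↔ (Fin (f zero) ⊎ Σ (Fin n) (Fin ∘ f ∘ suc))
  Σ-Fin-suc f = mk↔ₛ′
    (λ { (zero , j) → inj₁ j ; (suc i , j) → inj₂ (i , j) })
    (λ { (inj₁ j) → zero , j ; (inj₂ (i , j)) → suc i , j })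
    (λ { (inj₁ _) → refl ; (inj₂ _) → refl })
    (λ { (zero , _) → refl ; (suc _ , _) → refl })

  Σ-Fin-finite : ∀ {n} (f : Fin n → ℕ) → Finite (Σ (Fin n) (Fin ∘ f))
  Σ-Fin-finite {zero} f = 0 , mk↔ₛ′ (λ ()) (λ ()) (λ ()) (λ ())
  Σ-Fin-finite {suc n} f with Σ-Fin-finite (f ∘ suc)
  ... | _ , Σ↔Fin = _ , ↔-sym +↔⊎ ↔-∘ ((↔-refl ⊎-↔ Σ↔Fin) ↔-∘ Σ-Fin-suc f)

Σ-finite : ∀ {A} → Finite A → (f : A → ℕ) → Finite (Σ A (Fin ∘ f))
Σ-finite {A} (n , A↔Fin) f with Σ-Fin-finite (f ∘ Inverse.from A↔Fin)
... | m , Σ↔Fin = m , Σ↔Fin ↔-∘ ↔-sym (Σ-↔ (↔-sym A↔Fin) ↔-refl)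

-- Finite loopless multigraphs: parallel edges are distinct elements of E with
-- the same end vertices.  The order of the two components of  ends e  carries
-- no information; every notion below uses it only through Incident.
record Graph : Set₁ where
  field
    V        : Set
    E        : Set
    V-finite : Finite V
    E-finite : Finite E
    ends     : E → V × V
    loopless : ∀ e → proj₁ (ends e) ≢ proj₂ (ends e)

  Incident : V → E → Set
  Incident v e = v ≡ proj₁ (ends e) ⊎ v ≡ proj₂ (ends e)

  incident? : ∀ v e → Dec (Incident v e)
  incident? v e = (v ≟ proj₁ (ends e)) ⊎-dec (v ≟ proj₂ (ends e))
    where _≟_ = finite⇒≟ V-finite

  Adjacent : E → E → Set
  Adjacent e f = e ≢ f × ∃ λ v → Incident v e × Incident v f

  degree : V → ℕ
  degree v = length (filter (incident? v) (elements E-finite))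

  maxDegree : ℕ
  maxDegree = max 0 (map degree (elements V-finite))

  EdgeSet : Set
  EdgeSet = E → Bool

  _∈E_ : E → EdgeSet → Set
  e ∈E N = T (N e)

open Graph

Cubic : Graph → Set
Cubic G = ∀ v → degree G v ≡ 3

IsLeast : (ℕ → Set) → ℕ → Set
IsLeast P k = P k × (∀ j → P j → k ≤ j)

EdgeColourable : Graph → ℕ → Set
EdgeColourable G k = ∃ λ (c : E G → Fin k) → ∀ e f → Adjacent G e f → c e ≢ c f

IsChromaticIndex : Graph → ℕ → Set
IsChromaticIndex G = IsLeast (EdgeColourable G)

ClassI : Graph → Set
ClassI G = IsChromaticIndex G (maxDegree G)

IsMatching : (G : Graph) → EdgeSet G → Set
IsMatching G M = ∀ e f → _∈E_ G e M → _∈E_ G f M → ¬ Adjacent G e f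

IsPerfectMatching : (G : Graph) → EdgeSet G → Set
IsPerfectMatching G M =
  IsMatching G M × (∀ v → ∃ λ e → _∈E_ G e M × Incident G v e)

multiplicity : (H : Graph) {t : ℕ} → (Fin t → EdgeSet H) → E H → ℕ
multiplicity H {t} N e = length (filter (λ i → T? (N i e)) (allFin t))

-- H + N₁ + ⋯ + Nₜ.  The pair (e , zero) is the original edge e, and the pairs
-- (e , suc j) are the parallel copies added to it.
_⊞_ : (H : Graph) {t : ℕ} → (Fin t → EdgeSet H) → Graph
H ⊞ N = record
  { V        = V H
  ; E        = Σ (E H) λ e → Fin (suc (multiplicity H N e))
  ; V-finite = V-finite H
  ; E-finite = Σ-finite (E-finite H) (suc ∘ multiplicity H N)
  ; ends     = ends H ∘ proj₁
  ; loopless = loopless H ∘ proj₁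
  }

ClassIAfterAdding : Graph → ℕ → Set
ClassIAfterAdding H k =
  ∃ λ (M : Fin k → EdgeSet H) → (∀ i → IsPerfectMatching H (M i)) × ClassI (H ⊞ M)

-- l(H) is given as a relation because the minimum of a subset of ℕ need not be
-- computable; ⊤⁺ is the value +∞.
l[_]≡_ : Graph → ℕ ⁺ → Set
l[ H ]≡ [ n ] = IsLeast (ClassIAfterAdding H) n
l[ H ]≡ ⊤⁺    = ∀ k → ¬ ClassIAfterAdding H k

{-# OPTIONS --safe #-}

-- The graph is a chain of n levels between a triangle and a single vertex, the
-- apex; three links join consecutive pieces.  A level is a six-cycle
-- x₀ y₂ x₁ y₀ x₂ y₁ whose x's carry the incoming and whose y's carry the outgoing
-- links, and x₀ is replaced by a gadget, the Petersen graph minus a vertex.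
--
-- Call a perfect matching full at a gadget if it contains all three edges leaving
-- it; otherwise it contains exactly one of them.  Counting edges at the x's and at
-- the y's, a perfect matching loses two links across a level where it is full, and
-- none across the other levels.  It has at most three links at the triangle and one
-- at the apex, so it is full at most once.
--
-- A class I graph H + M₁ + ⋯ + Mₖ splits into perfect matchings N₁, …, Nₖ₊₃ with
-- ∑ N = E + ∑ M.  If no Mᵢ is full at a gadget, counting the three edges leaving it
-- shows that no Nⱼ is.  But a perfect matching that is not full contains an even
-- number of three alternate edges on the hexagon of the gadget, so 3 would be even.
-- Hence each gadget is full in some Mᵢ, and n ≤ k.
--
-- Conversely there are two perfect matchings full at the i-th gadget that differ
-- only by swapping the two alternate triples of its hexagon.  Taking one of them as
-- Mᵢ, the other as a colour class, and adding three colour classes that are nowhere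
-- full gives ∑ N = E + ∑ M.
module Submission where

open import Defs
open import Algebra.Properties.CommutativeMonoid.Sum using ()
open import Data.Bool using (Bool; true; false; T; _∧_; not)
open import Data.Bool.Properties using (T?) renaming (_≟_ to _≟ᵇ_)
open import Data.Empty using (⊥; ⊥-elim)
open import Data.Fin using (Fin; zero; suc; cast; inject₁; fromℕ)
open import Data.Fin.Patterns using (0F; 1F; 2F)
open import Data.Fin.Properties as Fin
  using (any?; all?; injective⇒≤; cast-involutive; 2↔Bool; +↔⊎; *↔×) renaming (_≟_ to _≟ꟳ_)
open import Data.Fin.Relation.Unary.Top using (View; view; ‵fromℕ; ‵inject₁; view-fromℕ; view-inject₁)
open import Data.List using (List; []; _∷_; _++_; length; lookup; filter; map; tabulate; allFin)
open import Data.List.Extrema.Nat using (max≤v⁺; v≤max⁺)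
open import Data.List.Membership.Propositional using (_∈_)
open import Data.List.Membership.Propositional.Properties
  using (∈-map⁺; ∈-map⁻; ∈-++⁺ˡ; ∈-++⁺ʳ; ∈-++⁻; ∈-filter⁺; ∈-filter⁻; ∈-lookup; ∈-allFin; ∈-tabulate⁺; ∈-tabulate⁻)
open import Data.List.Membership.Propositional.Properties.WithK using (unique∧set⇒bag)
open import Data.List.Properties using (length-++; length-map; length-tabulate)
open import Data.List.Relation.Binary.BagAndSetEquality using (∼bag⇒↭)
open import Data.List.Relation.Binary.Permutation.Propositional.Properties using (↭-length)
open import Data.List.Relation.Unary.All as All using ()
import Data.List.Relation.Unary.All.Properties as All
open import Data.List.Relation.Unary.AllPairs using ([]; _∷_)
open import Data.List.Relation.Unary.Any as Any using (here; there)
open import Data.List.Relation.Unary.Unique.Propositional using (Unique)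
open import Data.List.Relation.Unary.Unique.Propositional.Properties using (map⁺; ++⁺; allFin⁺; tabulate⁺; filter⁺)
open import Data.Nat using (ℕ; zero; suc; _+_; _*_; _≤_; _≥_; _≟_; z≤n)
open import Data.Nat.Divisibility using (_∣_; divides; ∣m∣n⇒∣m+n; ∣m+n∣m⇒∣n; _∣?_; _∣0)
open import Data.Nat.Properties
  using ( +-0-commutativeMonoid; +-assoc; +-comm; +-identityʳ; +-cancelʳ-≡; +-cancelˡ-≡; +-cancelˡ-≤; +-mono-≤
        ; *-zeroʳ; *-cancelˡ-≡; *-cancelˡ-≤; ≤-refl; ≤-reflexive; ≤-trans; ≤-antisym; ≤-pred; 1+n≰n; m≤n+m; n≤0⇒n≡0
        ; module ≤-Reasoning )
open import Data.Nat.Tactic.RingSolver using (solve-∀)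
open import Data.Product using (∃; _×_; _,_; proj₁; proj₂)
open import Data.Product.Function.NonDependent.Propositional using (_×-↔_)
open import Data.Product.Properties using (,-injectiveʳ)
open import Data.Sum using (_⊎_; inj₁; inj₂; [_,_]′)
open import Data.Sum.Function.Propositional using (_⊎-↔_)
open import Data.Unit using (tt)
open import Function using (_∘_; Inverse; mk⇔)
open import Function.Construct.Composition using (_↔-∘_)
open import Function.Properties.Inverse using (↔-refl; ↔-sym)
open import Relation.Binary.PropositionalEquality
open import Relation.Nullary using (¬_; Dec; yes; no; contradiction)
open import Relation.Nullary.Construct.Add.Supremum using ([_])
open import Relation.Nullary.Decidable
  using (⌊_⌋; map′; toWitness; fromWitness; from-yes; from-no; decidable-stable; ¬?)
open import Relation.Unary using (Decidable)

open Algebra.Properties.CommutativeMonoid.Sum +-0-commutativeMonoid using (sum; sum-cong-≗)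
open Graph

-- Counting

⟦_⟧ : Bool → ℕ
⟦ true ⟧  = 1
⟦ false ⟧ = 0

#_ : ∀ {n} → (Fin n → Bool) → ℕ
# f = sum (⟦_⟧ ∘ f)

sum-const : ∀ n {m} → sum {n} (λ _ → m) ≡ n * m
sum-const zero    = refl
sum-const (suc n) = cong (_ +_) (sum-const n)

length-filter-T : ∀ {A : Set} {n} (f : A → Bool) (g : Fin n → A) →
                  length (filter (T? ∘ f) (tabulate g)) ≡ # (f ∘ g)
length-filter-T {n = zero}  f g = refl
length-filter-T {n = suc n} f g with f (g zero)
... | true  = cong suc (length-filter-T f (g ∘ suc))
... | false = length-filter-T f (g ∘ suc)

-- Duplicate-free lists with the same members are permutations of each other. Degrees and counts can
-- thus be read off from any explicit list, whatever the enumeration behind `elements`.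
unique-length : ∀ {A : Set} {xs ys : List A} → Unique xs → Unique ys →
                (∀ {x} → x ∈ xs → x ∈ ys) → (∀ {x} → x ∈ ys → x ∈ xs) →
                length xs ≡ length ys
unique-length xs! ys! to from =
  ↭-length (∼bag⇒↭ (unique∧set⇒bag xs! ys! (mk⇔ to from)))

lookup-injective : ∀ {A : Set} {xs : List A} → Unique xs →
                   ∀ {i j} → lookup xs i ≡ lookup xs j → i ≡ j
lookup-injective (_ ∷ _)    {zero}  {zero}  _  = refl
lookup-injective (x∉ ∷ _)   {zero}  {suc j} eq = ⊥-elim (All.lookup x∉ (∈-lookup j) eq)
lookup-injective (x∉ ∷ _)   {suc i} {zero}  eq = ⊥-elim (All.lookup x∉ (∈-lookup i) (sym eq))
lookup-injective (_ ∷ xs!)  {suc i} {suc j} eq = cong suc (lookup-injective xs! eq)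

unique-length≤ : ∀ {n} {xs : List (Fin n)} → Unique xs → length xs ≤ n
unique-length≤ xs! = injective⇒≤ (lookup-injective xs!)

-- A missing `j` could be prepended, giving `n + 1` distinct elements of `Fin n`.
unique-complete : ∀ {n} {xs : List (Fin n)} → Unique xs → length xs ≡ n → ∀ j → j ∈ xs
unique-complete {n} {xs} xs! len j with Any.any? (j ≟ꟳ_) xs
... | yes j∈ = j∈
... | no  j∉ = contradiction
  (subst (_≤ n) (cong suc len) (unique-length≤ (All.¬Any⇒All¬ xs j∉ ∷ xs!))) 1+n≰n

map-unique : ∀ {A B : Set} (f : A → B) {xs : List A} → Unique xs →
             (∀ {x y} → x ∈ xs → y ∈ xs → f x ≡ f y → x ≡ y) → Unique (map f xs)
map-unique f []         inj = []
map-unique f (x∉ ∷ xs!) inj =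
  All.map⁺ (All.tabulate λ y∈ eq → All.lookup x∉ y∈ (inj (here refl) (there y∈) eq))
  ∷ map-unique f xs! λ x∈ y∈ → inj (there x∈) (there y∈)

elements-unique : ∀ {A} (fin : Finite A) → Unique (elements fin)
elements-unique (n , A↔Fin) = map⁺ (λ {x} {y} eq →
  trans (sym (inverseˡ refl)) (trans (cong to eq) (inverseˡ refl))) (allFin⁺ n)
  where open Inverse A↔Fin

∈-elements : ∀ {A} (fin : Finite A) x → x ∈ elements fin
∈-elements (n , A↔Fin) x =
  subst (_∈ _) (inverseʳ refl) (∈-map⁺ from (∈-allFin (to x)))
  where open Inverse A↔Fin

filter-length : ∀ {A : Set} (fin : Finite A) {P : A → Set} (P? : Decidable P) {xs : List A} →
                Unique xs → (∀ {x} → P x → x ∈ xs) → (∀ {x} → x ∈ xs → P x) →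
                length (filter P? (elements fin)) ≡ length xs
filter-length fin P? xs! to from =
  unique-length (filter⁺ P? (elements-unique fin)) xs!
    (λ x∈ → to (proj₂ (∈-filter⁻ P? {xs = elements fin} x∈)))
    (λ x∈ → ∈-filter⁺ P? (∈-elements fin _) (from x∈))

count-length : ∀ {n} (f : Fin n → Bool) {xs : List (Fin n)} → Unique xs →
               (∀ {j} → T (f j) → j ∈ xs) → (∀ {j} → j ∈ xs → T (f j)) → # f ≡ length xs
count-length {n} f xs! to from = trans (sym (length-filter-T f (λ j → j)))
  (unique-length (filter⁺ (T? ∘ f) (allFin⁺ n)) xs!
    (λ j∈ → to (proj₂ (∈-filter⁻ (T? ∘ f) {xs = allFin n} j∈)))
    (λ j∈ → ∈-filter⁺ (T? ∘ f) (∈-allFin _) (from j∈)))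

degree-length : ∀ (G : Graph) {v} {xs : List (E G)} → Unique xs →
                (∀ {e} → Incident G v e → e ∈ xs) → (∀ {e} → e ∈ xs → Incident G v e) →
                degree G v ≡ length xs
degree-length G {v} = filter-length (E-finite G) (incident? G v)

-- The vertex rules out the empty graph, whose `maxDegree` is 0.
maxDegree-regular : ∀ (G : Graph) {d} → V G → (∀ v → degree G v ≡ d) → maxDegree G ≡ d
maxDegree-regular G v regular = ≤-antisym
  (max≤v⁺ {xs = map (degree G) (elements (V-finite G))} z≤n
    (All.map⁺ (All.tabulate λ {w} _ → ≤-reflexive (regular w))))
  (v≤max⁺ 0 _ (inj₂ (Any.map (≤-reflexive ∘ trans (sym (regular v)))
    (∈-map⁺ (degree G) (∈-elements (V-finite G) v)))))

-- Exactly one of three edges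

sum₃ : Bool → Bool → Bool → ℕ
sum₃ a b c = ⟦ a ⟧ + ⟦ b ⟧ + ⟦ c ⟧

sum₃≤3 : ∀ a b c → sum₃ a b c ≤ 3
sum₃≤3 a b c = +-mono-≤ (+-mono-≤ (≤1 a) (≤1 b)) (≤1 c)
  where
  ≤1 : ∀ b → ⟦ b ⟧ ≤ 1
  ≤1 true  = ≤-refl
  ≤1 false = z≤n

-- An inductive type rather than the equation `sum₃ a b c ≡ 1`, so that matching on a proof fixes
-- all three values; the case analysis of the gadget runs on this.
data One : Bool → Bool → Bool → Set where
  first  : One true false false
  second : One false true false
  third  : One false false true

one-sum : ∀ {a b c} → One a b c → sum₃ a b c ≡ 1
one-sum first  = refl
one-sum second = refl
one-sum third  = refl

one? : ∀ a b c → Dec (One a b c)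
one? true  false false = yes first
one? false true  false = yes second
one? false false true  = yes third
one? true  true  _     = no λ ()
one? true  false true  = no λ ()
one? false true  true  = no λ ()
one? false false false = no λ ()

one-index : ∀ {f : Fin 3 → Bool} → One (f 0F) (f 1F) (f 2F) → ∃ λ a → T (f a) × ∀ b → T (f b) → b ≡ a
one-index {f} = go (f 0F) (f 1F) (f 2F) refl refl refl
  where
  go : ∀ x y z → f 0F ≡ x → f 1F ≡ y → f 2F ≡ z → One x y z → ∃ λ a → T (f a) × ∀ b → T (f b) → b ≡ a
  go _ _ _ p q r first  = 0F , subst T (sym p) tt , λ where
    0F _ → refl
    1F t → ⊥-elim (subst T q t)
    2F t → ⊥-elim (subst T r t)
  go _ _ _ p q r second = 1F , subst T (sym q) tt , λ where
    0F t → ⊥-elim (subst T p t)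
    1F _ → refl
    2F t → ⊥-elim (subst T r t)
  go _ _ _ p q r third  = 2F , subst T (sym r) tt , λ where
    0F t → ⊥-elim (subst T p t)
    1F t → ⊥-elim (subst T q t)
    2F _ → refl

-- The form `1 + 2 * ⟦ τ i ⟧` serves two uses: at a vertex the sum is 1, and at a gadget it is 1 or
-- 3, with `τ` marking the full matchings.
sum₃-sum : ∀ {t} {f g h τ : Fin t → Bool} →
           (∀ i → sum₃ (f i) (g i) (h i) ≡ 1 + 2 * ⟦ τ i ⟧) → # f + # g + # h ≡ t + 2 * # τ
sum₃-sum {zero}  one = refl
sum₃-sum {suc t} {f} {g} {h} {τ} one = begin
  # f + # g + # h
    ≡⟨ gather ⟦ f zero ⟧ ⟦ g zero ⟧ ⟦ h zero ⟧ (# (f ∘ suc)) (# (g ∘ suc)) (# (h ∘ suc)) ⟩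
  sum₃ (f zero) (g zero) (h zero) + (# (f ∘ suc) + # (g ∘ suc) + # (h ∘ suc))
    ≡⟨ cong₂ _+_ (one zero) (sum₃-sum (one ∘ suc)) ⟩
  1 + 2 * ⟦ τ zero ⟧ + (t + 2 * # (τ ∘ suc))
    ≡⟨ regroup ⟦ τ zero ⟧ t (# (τ ∘ suc)) ⟩
  suc t + 2 * # τ ∎
  where
  open ≡-Reasoning
  gather : ∀ a b c x y z → a + x + (b + y) + (c + z) ≡ a + b + c + (x + y + z)
  gather = solve-∀
  regroup : ∀ a t x → 1 + 2 * a + (t + 2 * x) ≡ suc t + 2 * (a + x)
  regroup = solve-∀

sum-one : ∀ {t} {f g h : Fin t → Bool} → (∀ i → One (f i) (g i) (h i)) → # f + # g + # h ≡ t
sum-one {t} {f} {g} {h} one = begin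
  # f + # g + # h                     ≡⟨ sum₃-sum {f = f} {g} {h} {λ _ → false} (one-sum ∘ one) ⟩
  t + 2 * # (λ (_ : Fin t) → false)   ≡⟨ cong (λ m → t + 2 * m) (trans (sum-const t) (*-zeroʳ t)) ⟩
  t + 0                               ≡⟨ +-identityʳ t ⟩
  t                                   ∎
  where open ≡-Reasoning

sum₃-even : ∀ {t} (f g h : Fin t → Bool) → (∀ i → 2 ∣ sum₃ (f i) (g i) (h i)) → 2 ∣ # f + # g + # h
sum₃-even {zero}  f g h even = 2 ∣0
sum₃-even {suc t} f g h even =
  subst (2 ∣_) (gather ⟦ f zero ⟧ ⟦ g zero ⟧ ⟦ h zero ⟧ (# (f ∘ suc)) (# (g ∘ suc)) (# (h ∘ suc)))
    (∣m∣n⇒∣m+n (even zero) (sum₃-even (f ∘ suc) (g ∘ suc) (h ∘ suc) (even ∘ suc)))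
  where
  gather : ∀ a b c x y z → a + b + c + (x + y + z) ≡ a + x + (b + y) + (c + z)
  gather = solve-∀

#-zero : ∀ {n} (f : Fin n → Bool) → # f ≡ 0 → ∀ i → f i ≡ false
#-zero {suc n} f #f≡0 i with f zero in eq
#-zero {suc n} f #f≡0 zero    | false = eq
#-zero {suc n} f #f≡0 (suc i) | false = #-zero (f ∘ suc) #f≡0 i

#-unique : ∀ {n} (f : Fin n → Bool) → # f ≤ 1 → ∀ {i j} → T (f i) → T (f j) → i ≡ j
#-unique {suc n} f #f≤1 {i} {j} fi fj with f zero in eq
#-unique {suc n} f #f≤1 {zero}  {zero}  fi fj | _     = refl
#-unique {suc n} f #f≤1 {suc i} {suc j} fi fj | b     =
  cong suc (#-unique (f ∘ suc) (≤-trans (m≤n+m (# (f ∘ suc)) ⟦ b ⟧) #f≤1) fi fj)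
#-unique {suc n} f #f≤1 {zero}  {suc j} fi fj | true  =
  ⊥-elim (subst T (#-zero (f ∘ suc) (n≤0⇒n≡0 (≤-pred #f≤1)) j) fj)
#-unique {suc n} f #f≤1 {suc i} {zero}  fi fj | true  =
  ⊥-elim (subst T (#-zero (f ∘ suc) (n≤0⇒n≡0 (≤-pred #f≤1)) i) fi)
#-unique {suc n} f #f≤1 {zero}  {suc j} fi fj | false = ⊥-elim (subst T eq fi)
#-unique {suc n} f #f≤1 {suc i} {zero}  fi fj | false = ⊥-elim (subst T eq fj)

-- Here `L` will count the links of a matching between consecutive pieces, and `τ` will mark the
-- levels where two of them are lost.
telescope : ∀ {n} (L : Fin (suc n) → ℕ) (τ : Fin n → ℕ) →
            (∀ l → L (inject₁ l) ≡ L (suc l) + 2 * τ l) → L zero ≡ L (fromℕ n) + 2 * sum τ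
telescope {zero}  L τ step = sym (+-identityʳ _)
telescope {suc n} L τ step = trans (step zero)
  (trans (cong (_+ 2 * τ zero) (telescope (L ∘ suc) (τ ∘ suc) (step ∘ suc)))
         (regroup (L (fromℕ (suc n))) (sum (τ ∘ suc)) (τ zero)))
  where
  regroup : ∀ a b c → a + 2 * b + 2 * c ≡ a + 2 * (c + b)
  regroup = solve-∀

-- Class I graphs and decompositions into perfect matchings

-- A numbering of the three edges at every vertex. By `slot` no other edge is incident, so
-- conditions at a vertex become conditions on three Booleans.
record Slots (G : Graph) : Set where
  field
    inc           : V G → Fin 3 → E G
    inc-injective : ∀ v {a b} → inc v a ≡ inc v b → a ≡ b
    incident      : ∀ v a → Incident G v (inc v a)
    slot          : ∀ {v e} → Incident G v e → ∃ λ a → inc v a ≡ e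

module _ {H : Graph} (S : Slots H) where
  open Slots S

  OneAt : EdgeSet H → V H → Set
  OneAt F v = One (F (inc v 0F)) (F (inc v 1F)) (F (inc v 2F))

  private
    distinct-slots : ∀ {v a b} → a ≢ b → Adjacent H (inc v a) (inc v b)
    distinct-slots {v} {a} {b} a≢b = a≢b ∘ inc-injective v , v , incident v a , incident v b

  perfect⇒one : ∀ {F} → IsPerfectMatching H F → ∀ v → OneAt F v
  perfect⇒one {F} (matching , covers) v with covers v
  ... | e , e∈F , inc-e with slot inc-e
  ...   | a , refl = go (F (inc v 0F)) (F (inc v 1F)) (F (inc v 2F)) refl refl refl a e∈F
    where
    clash : ∀ {a b} → a ≢ b → F (inc v a) ≡ true → F (inc v b) ≡ true → ∀ {W : Set} → W
    clash a≢b p q = ⊥-elim (matching _ _ (subst T (sym p) tt) (subst T (sym q) tt) (distinct-slots a≢b))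

    go : ∀ x y z → F (inc v 0F) ≡ x → F (inc v 1F) ≡ y → F (inc v 2F) ≡ z →
         ∀ a → T (F (inc v a)) → One x y z
    go true  true  _     p q r _ _ = clash (λ ()) p q
    go true  false true  p q r _ _ = clash (λ ()) p r
    go false true  true  p q r _ _ = clash (λ ()) q r
    go true  false false p q r _ _ = first
    go false true  false p q r _ _ = second
    go false false true  p q r _ _ = third
    go false false false p q r 0F t = ⊥-elim (subst T p t)
    go false false false p q r 1F t = ⊥-elim (subst T q t)
    go false false false p q r 2F t = ⊥-elim (subst T r t)

  one⇒perfect : ∀ {F} → (∀ v → OneAt F v) → IsPerfectMatching H F
  one⇒perfect {F} one = matching , covers
    where
    matching : IsMatching H F
    matching e f e∈F f∈F (e≢f , v , v∈e , v∈f) with slot v∈e | slot v∈f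
    ... | a , refl | b , refl =
      let _ , _ , unique = one-index {F ∘ inc v} (one v)
      in e≢f (cong (inc v) (trans (unique a e∈F) (sym (unique b f∈F))))

    covers : ∀ v → ∃ λ e → T (F e) × Incident H v e
    covers v = let a , t , _ = one-index {F ∘ inc v} (one v) in inc v a , t , incident v a

  cubic : Cubic H
  cubic v = degree-length H (tabulate⁺ {f = inc v} (inc-injective v))
    (λ v∈e → let a , eq = slot v∈e in subst (_∈ tabulate (inc v)) eq (∈-tabulate⁺ {f = inc v} a))
    (λ e∈ → let a , eq = ∈-tabulate⁻ {f = inc v} e∈ in subst (Incident H v) (sym eq) (incident v a))

  multiplicity-sum : ∀ {t} (N : Fin t → EdgeSet H) e → multiplicity H N e ≡ # (λ i → N i e)
  multiplicity-sum N e = length-filter-T (λ i → N i e) (λ i → i)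

  module _ {t} (M : Fin t → EdgeSet H) (perfect : ∀ i → IsPerfectMatching H (M i)) where

    private
      copies : (e : E H) → List (E (H ⊞ M))
      copies e = map (e ,_) (allFin (suc (multiplicity H M e)))

      star : V H → List (E (H ⊞ M))
      star v = copies (inc v 0F) ++ copies (inc v 1F) ++ copies (inc v 2F)

      copies-unique : ∀ e → Unique (copies e)
      copies-unique e = map⁺ (λ { refl → refl }) (allFin⁺ _)

      ∈-copies⁻ : ∀ {e x} → x ∈ copies e → proj₁ x ≡ e
      ∈-copies⁻ x∈ with ∈-map⁻ (_ ,_) x∈
      ... | _ , _ , refl = refl

      ∈-copies⁺ : ∀ x → x ∈ copies (proj₁ x)
      ∈-copies⁺ (e , i) = ∈-map⁺ (e ,_) (∈-allFin i)

      star-unique : ∀ v → Unique (star v)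
      star-unique v =
        ++⁺ (copies-unique _) (++⁺ (copies-unique _) (copies-unique _) λ (x∈ , y∈) → disjoint (λ ()) x∈ y∈)
          λ (x∈ , y∈) → [ disjoint (λ ()) x∈ , disjoint (λ ()) x∈ ]′ (∈-++⁻ (copies (inc v 1F)) y∈)
        where
        disjoint : ∀ {a b} → a ≢ b → ∀ {x} → x ∈ copies (inc v a) → x ∈ copies (inc v b) → ⊥
        disjoint a≢b x∈ y∈ = a≢b (inc-injective v (trans (sym (∈-copies⁻ x∈)) (∈-copies⁻ y∈)))

      ∈-star⁺ : ∀ v x → Incident H v (proj₁ x) → x ∈ star v
      ∈-star⁺ v x v∈x with slot v∈x
      ... | 0F , refl = ∈-++⁺ˡ (∈-copies⁺ x)
      ... | 1F , refl = ∈-++⁺ʳ (copies (inc v 0F)) (∈-++⁺ˡ (∈-copies⁺ x))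
      ... | 2F , refl = ∈-++⁺ʳ (copies (inc v 0F)) (∈-++⁺ʳ (copies (inc v 1F)) (∈-copies⁺ x))

      ∈-star⁻ : ∀ v {x} → x ∈ star v → Incident H v (proj₁ x)
      ∈-star⁻ v {x} x∈ with ∈-++⁻ (copies (inc v 0F)) x∈
      ... | inj₁ y∈ = subst (Incident H v) (sym (∈-copies⁻ y∈)) (incident v 0F)
      ... | inj₂ y∈ with ∈-++⁻ (copies (inc v 1F)) y∈
      ...   | inj₁ z∈ = subst (Incident H v) (sym (∈-copies⁻ z∈)) (incident v 1F)
      ...   | inj₂ z∈ = subst (Incident H v) (sym (∈-copies⁻ z∈)) (incident v 2F)

      length-copies : ∀ e → length (copies e) ≡ suc (# (λ i → M i e))
      length-copies e = trans (length-map _ (allFin (suc (multiplicity H M e))))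
        (trans (length-tabulate (λ i → i)) (cong suc (multiplicity-sum M e)))

      length-star : ∀ v → length (star v) ≡ 3 + t
      length-star v = begin
        length (star v)
          ≡⟨ length-++ (copies (inc v 0F)) ⟩
        length (copies (inc v 0F)) + length (copies (inc v 1F) ++ copies (inc v 2F))
          ≡⟨ cong₂ _+_ (length-copies _) (trans (length-++ (copies (inc v 1F)))
               (cong₂ _+_ (length-copies _) (length-copies _))) ⟩
        suc x + (suc y + suc z)
          ≡⟨ rearrange x y z ⟩
        3 + (x + y + z)
          ≡⟨ cong (3 +_) (sum-one (λ i → perfect⇒one (perfect i) v)) ⟩
        3 + t ∎
        where
        open ≡-Reasoning
        x = # λ i → M i (inc v 0F)
        y = # λ i → M i (inc v 1F)
        z = # λ i → M i (inc v 2F)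
        rearrange : ∀ x y z → suc x + (suc y + suc z) ≡ 3 + (x + y + z)
        rearrange = solve-∀

    -- Besides the three original edges, each `M i` adds exactly one parallel edge at `v`.
    ⊞-degree : ∀ v → degree (H ⊞ M) v ≡ 3 + t
    ⊞-degree v = trans (degree-length (H ⊞ M) (star-unique v) (∈-star⁺ v _) (∈-star⁻ v)) (length-star v)

    ⊞-maxDegree : V H → maxDegree (H ⊞ M) ≡ 3 + t
    ⊞-maxDegree v = maxDegree-regular (H ⊞ M) v ⊞-degree

    private
      _≟ᴱ_ = finite⇒≟ (E-finite (H ⊞ M))

      colours-unique : ∀ {k} (χ : EdgeColourable (H ⊞ M) k) v → Unique (map (proj₁ χ) (star v))
      colours-unique (c , proper) v = map-unique c (star-unique v) inj
        where
        inj : ∀ {x y} → x ∈ star v → y ∈ star v → c x ≡ c y → x ≡ y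
        inj {x} {y} x∈ y∈ eq with x ≟ᴱ y
        ... | yes x≡y = x≡y
        ... | no  x≢y = contradiction eq (proper x y (x≢y , v , ∈-star⁻ v x∈ , ∈-star⁻ v y∈))

    ⊞-colours≥ : V H → ∀ {k} → EdgeColourable (H ⊞ M) k → 3 + t ≤ k
    ⊞-colours≥ v {k} χ =
      subst (_≤ k) (trans (length-map (proj₁ χ) (star v)) (length-star v)) (unique-length≤ (colours-unique χ v))

    -- The `3 + t` edges at a vertex have different colours, so with exactly that many colours each
    -- colour occurs there, and every colour class projects to a perfect matching of `H`. Copies of
    -- one edge have different colours, hence the count. A variable `k` keeps `#` from unfolding its
    -- first three terms.
    colouring⇒matchings : ∀ {k} → k ≡ 3 + t → EdgeColourable (H ⊞ M) k →
      ∃ λ (N : Fin k → EdgeSet H) →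
        (∀ j v → OneAt (N j) v) × (∀ e → # (λ j → N j e) ≡ suc (# λ i → M i e))
    colouring⇒matchings {k} k≡3+t χ@(c , proper) =
      N , (λ j → perfect⇒one (matching j , covers j)) , count
      where
      used? : ∀ j e → Dec (∃ λ i → c (e , i) ≡ j)
      used? j e = any? λ i → c (e , i) ≟ꟳ j

      N : Fin k → EdgeSet H
      N j e = ⌊ used? j e ⌋

      N⁻ : ∀ {j e} → T (N j e) → ∃ λ i → c (e , i) ≡ j
      N⁻ {j} {e} = toWitness {a? = used? j e}

      N⁺ : ∀ {j e} i → c (e , i) ≡ j → T (N j e)
      N⁺ {j} {e} i eq = fromWitness {a? = used? j e} (i , eq)

      matching : ∀ j → IsMatching H (N j)
      matching j e f e∈ f∈ (e≢f , shared) with N⁻ e∈ | N⁻ f∈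
      ... | i , eq | i′ , eq′ = proper (e , i) (f , i′) (e≢f ∘ cong proj₁ , shared) (trans eq (sym eq′))

      covers : ∀ j v → ∃ λ e → T (N j e) × Incident H v e
      covers j v with ∈-map⁻ c (unique-complete (colours-unique χ v)
                        (trans (length-map c (star v)) (trans (length-star v) (sym k≡3+t))) j)
      ... | (e , i) , x∈ , eq = e , N⁺ i (sym eq) , ∈-star⁻ v x∈

      parallel : ∀ {e i i′} → c (e , i) ≡ c (e , i′) → i ≡ i′
      parallel {e} {i} {i′} eq with i ≟ꟳ i′
      ... | yes i≡i′ = i≡i′
      ... | no  i≢i′ = contradiction eq
        (proper _ _ ((λ { refl → i≢i′ refl }) , proj₁ (ends H e) , inj₁ refl , inj₁ refl))

      count : ∀ e → # (λ j → N j e) ≡ suc (# λ i → M i e)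
      count e = trans
        (count-length (λ j → N j e) (tabulate⁺ {f = λ i → c (e , i)} parallel)
          (λ j∈ → let i , eq = N⁻ j∈
                  in subst (_∈ tabulate (λ i → c (e , i))) eq (∈-tabulate⁺ {f = λ i → c (e , i)} i))
          (λ j∈ → let i , eq = ∈-tabulate⁻ {f = λ i → c (e , i)} j∈ in N⁺ i (sym eq)))
        (trans (length-tabulate (λ i → c (e , i))) (cong suc (multiplicity-sum M e)))

    -- The i-th copy of e receives the i-th colour j with e ∈ N j.
    matchings⇒colouring : ∀ {k} (N : Fin k → EdgeSet H) →
      (∀ j → IsPerfectMatching H (N j)) → (∀ e → # (λ j → N j e) ≡ suc (# λ i → M i e)) →
      EdgeColourable (H ⊞ M) k
    matchings⇒colouring {k} N N-perfect count = c , proper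
      where
      palette : E H → List (Fin k)
      palette e = filter (λ j → T? (N j e)) (allFin k)

      size : ∀ e → suc (multiplicity H M e) ≡ length (palette e)
      size e = trans (cong suc (multiplicity-sum M e))
        (trans (sym (count e)) (sym (length-filter-T (λ j → N j e) (λ j → j))))

      c : E (H ⊞ M) → Fin k
      c (e , i) = lookup (palette e) (cast (size e) i)

      c∈N : ∀ x → T (N (c x) (proj₁ x))
      c∈N (e , i) = proj₂ (∈-filter⁻ (λ j → T? (N j e)) {xs = allFin k} (∈-lookup (cast (size e) i)))

      same-edge : ∀ {e i i′} → c (e , i) ≡ c (e , i′) → i ≡ i′
      same-edge {e} {i} {i′} eq =
        trans (sym (cast-involutive (sym (size e)) (size e) i))
          (trans (cong (cast (sym (size e))) (lookup-injective (filter⁺ (λ j → T? (N j e)) (allFin⁺ k)) eq))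
            (cast-involutive (sym (size e)) (size e) i′))

      proper : ∀ x y → Adjacent (H ⊞ M) x y → c x ≢ c y
      proper x@(e , i) y@(f , i′) (x≢y , shared) eq with finite⇒≟ (E-finite H) e f
      ... | yes refl = x≢y (cong (e ,_) (same-edge eq))
      -- Distinct edges with a common end and a common colour would both lie in the matching
      -- `N (c x)`.
      ... | no  e≢f  = proj₁ (N-perfect (c x)) e f (c∈N x)
                         (subst (λ j → T (N j f)) (sym eq) (c∈N y)) (e≢f , shared)

    classI⇒matchings : V H → ClassI (H ⊞ M) →
      ∃ λ (N : Fin (3 + t) → EdgeSet H) →
        (∀ j v → OneAt (N j) v) × (∀ e → # (λ j → N j e) ≡ suc (# λ i → M i e))
    classI⇒matchings v (χ , _) =
      colouring⇒matchings refl (subst (EdgeColourable (H ⊞ M)) (⊞-maxDegree v) χ)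

    matchings⇒classI : V H → (N : Fin (3 + t) → EdgeSet H) →
      (∀ j → IsPerfectMatching H (N j)) → (∀ e → # (λ j → N j e) ≡ suc (# λ i → M i e)) →
      ClassI (H ⊞ M)
    matchings⇒classI v N N-perfect count =
      subst (IsChromaticIndex (H ⊞ M)) (sym (⊞-maxDegree v))
        (matchings⇒colouring N N-perfect count , λ _ → ⊞-colours≥ v)

-- The chain

Fin-finite : ∀ n → Finite (Fin n)
Fin-finite n = n , ↔-refl

Bool-finite : Finite Bool
Bool-finite = 2 , ↔-sym 2↔Bool

infixr 2 _×-finite_
infixr 1 _⊎-finite_

_×-finite_ : ∀ {A B} → Finite A → Finite B → Finite (A × B)
(_ , A↔) ×-finite (_ , B↔) = _ , ↔-sym *↔× ↔-∘ (A↔ ×-↔ B↔)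

_⊎-finite_ : ∀ {A B} → Finite A → Finite B → Finite (A ⊎ B)
(_ , A↔) ⊎-finite (_ , B↔) = _ , ↔-sym +↔⊎ ↔-∘ (A↔ ⊎-↔ B↔)

-- This lets `from-yes` settle the finite checks on a level by evaluation.
finite-all? : ∀ {A} → Finite A → {P : A → Set} → Decidable P → Dec (∀ x → P x)
finite-all? (_ , A↔) {P} P? = map′
  (λ all x → subst P (strictlyInverseʳ x) (all (to x)))
  (λ all i → all (from i))
  (all? (P? ∘ from))
  where open Inverse A↔

next prev : Fin 3 → Fin 3
next 0F = 1F
next 1F = 2F
next 2F = 0F
prev 0F = 2F
prev 1F = 0F
prev 2F = 1F

-- A `Stub` is an edge end at a vertex of the level: the end of an incoming link, of an outgoing
-- link, or one of the two ends of an inner edge. A `State` names one of the six ways in which the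
-- matchings of the upper bound meet a level.
LevelVertex LevelEdge Stub State : Set
LevelVertex = Fin 3 ⊎ (Fin 3 × Bool) ⊎ Bool ⊎ Fin 3
LevelEdge   = Fin 3 × Fin 3 × Bool
Stub        = Fin 3 ⊎ Fin 3 ⊎ (LevelEdge × Bool)
State       = Fin 3 ⊎ Bool ⊎ Fin 1

-- The terminals are the neighbours of the removed vertex of the Petersen graph.  Its
-- hexagon is K₃,₃ minus a perfect matching: the edge  rim a p  joins  hexagon a false
-- to  hexagon (a ± 1) true.  Likewise  cross a p  joins y_a to x_{a ± 1}, where y_a is
-- exit a, the vertices x₁ and x₂ are  middle false  and  middle true, and the three
-- edges at x₀ end in the terminals.
pattern terminal a  = inj₁ a
pattern hexagon a p = inj₂ (inj₁ (a , p))
pattern middle p    = inj₂ (inj₂ (inj₁ p))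
pattern exit a      = inj₂ (inj₂ (inj₂ a))

pattern spoke a p = 0F , a , p
pattern rim a p   = 1F , a , p
pattern cross a p = 2F , a , p

pattern input a   = inj₁ a
pattern output a  = inj₂ (inj₁ a)
pattern inner e s = inj₂ (inj₂ (e , s))

pattern usual a  = inj₁ a
pattern switch p = inj₂ (inj₁ p)
pattern pass     = inj₂ (inj₂ 0F)

levelVertex-finite : Finite LevelVertex
levelVertex-finite =
  Fin-finite 3 ⊎-finite (Fin-finite 3 ×-finite Bool-finite) ⊎-finite Bool-finite ⊎-finite Fin-finite 3

levelEdge-finite : Finite LevelEdge
levelEdge-finite = Fin-finite 3 ×-finite Fin-finite 3 ×-finite Bool-finite

stub-finite : Finite Stub
stub-finite = Fin-finite 3 ⊎-finite Fin-finite 3 ⊎-finite (levelEdge-finite ×-finite Bool-finite)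

state-finite : Finite State
state-finite = Fin-finite 3 ⊎-finite Bool-finite ⊎-finite Fin-finite 1

-- Slot 0 of a terminal holds its edge out of the gadget. The slots are ordered as `gadget-type` and
-- `level-flow` expect their arguments.
levelStub : LevelVertex → Fin 3 → Stub
levelStub (terminal 0F) 0F     = input 0F
levelStub (terminal 1F) 0F     = inner (cross 2F false) true
levelStub (terminal 2F) 0F     = inner (cross 1F true) true
levelStub (terminal a) 1F      = inner (spoke a false) false
levelStub (terminal a) 2F      = inner (spoke a true) false
levelStub (hexagon a p) 0F     = inner (spoke a p) true
levelStub (hexagon a false) 1F = inner (rim a false) false
levelStub (hexagon a false) 2F = inner (rim a true) false
levelStub (hexagon a true) 1F  = inner (rim (prev a) false) true
levelStub (hexagon a true) 2F  = inner (rim (next a) true) true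
levelStub (middle false) 0F    = input 1F
levelStub (middle false) 1F    = inner (cross 0F false) true
levelStub (middle false) 2F    = inner (cross 2F true) true
levelStub (middle true) 0F     = input 2F
levelStub (middle true) 1F     = inner (cross 1F false) true
levelStub (middle true) 2F     = inner (cross 0F true) true
levelStub (exit a) 0F          = output a
levelStub (exit a) 1F          = inner (cross a false) false
levelStub (exit a) 2F          = inner (cross a true) false

stubEnd : Stub → LevelVertex × Fin 3
stubEnd (input 0F)                    = terminal 0F , 0F
stubEnd (input 1F)                    = middle false , 0F
stubEnd (input 2F)                    = middle true , 0F
stubEnd (output a)                    = exit a , 0F
stubEnd (inner (spoke a false) false) = terminal a , 1F
stubEnd (inner (spoke a true) false)  = terminal a , 2F
stubEnd (inner (spoke a p) true)      = hexagon a p , 0F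
stubEnd (inner (rim a false) false)   = hexagon a false , 1F
stubEnd (inner (rim a false) true)    = hexagon (next a) true , 1F
stubEnd (inner (rim a true) false)    = hexagon a false , 2F
stubEnd (inner (rim a true) true)     = hexagon (prev a) true , 2F
stubEnd (inner (cross a false) false) = exit a , 1F
stubEnd (inner (cross a true) false)  = exit a , 2F
stubEnd (inner (cross 0F false) true) = middle false , 1F
stubEnd (inner (cross 1F false) true) = middle true , 1F
stubEnd (inner (cross 2F false) true) = terminal 1F , 0F
stubEnd (inner (cross 0F true) true)  = middle true , 2F
stubEnd (inner (cross 1F true) true)  = terminal 2F , 0F
stubEnd (inner (cross 2F true) true)  = middle false , 2F

levelStub-stubEnd : ∀ s → levelStub (proj₁ (stubEnd s)) (proj₂ (stubEnd s)) ≡ s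
levelStub-stubEnd = from-yes (finite-all? stub-finite λ s →
  finite⇒≟ stub-finite (levelStub (proj₁ (stubEnd s)) (proj₂ (stubEnd s))) s)

stubEnd-levelStub : ∀ v a → stubEnd (levelStub v a) ≡ (v , a)
stubEnd-levelStub = from-yes (finite-all? levelVertex-finite λ v → all? λ a →
  finite⇒≟ (levelVertex-finite ×-finite Fin-finite 3) (stubEnd (levelStub v a)) (v , a))

inner-loopless : ∀ e → proj₁ (stubEnd (inner e false)) ≢ proj₁ (stubEnd (inner e true))
inner-loopless = from-yes (finite-all? levelEdge-finite λ e →
  ¬? (finite⇒≟ levelVertex-finite (proj₁ (stubEnd (inner e false))) (proj₁ (stubEnd (inner e true)))))

-- Gluing the levels together

module _ (n : ℕ) where

  -- Level `l` lies between the triples of links `inject₁ l` and `suc l`, so `n` levels need `suc n`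
  -- triples.
  Vertex Edge : Set
  Vertex = Fin 3 ⊎ Fin 1 ⊎ (Fin n × LevelVertex)
  Edge   = Fin 3 ⊎ (Fin (suc n) × Fin 3) ⊎ (Fin n × LevelEdge)

pattern corner a = inj₁ a
pattern apex     = inj₂ (inj₁ 0F)
pattern at l v   = inj₂ (inj₂ (l , v))

pattern side a     = inj₁ a
pattern link l a   = inj₂ (inj₁ (l , a))
pattern within l e = inj₂ (inj₂ (l , e))

module _ {n : ℕ} where

  lift : Fin n → LevelVertex × Fin 3 → Vertex n × Fin 3
  lift l (v , a) = at l v , a

  linkLeft : Fin (suc n) → Fin 3 → Vertex n × Fin 3
  linkLeft zero    a = corner a , 0F
  linkLeft (suc l) a = lift l (stubEnd (output a))

  rightEnd : {l : Fin (suc n)} → View l → Fin 3 → Vertex n × Fin 3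
  rightEnd ‵fromℕ       a = apex , a
  rightEnd (‵inject₁ i) a = lift i (stubEnd (input a))

  linkRight : Fin (suc n) → Fin 3 → Vertex n × Fin 3
  linkRight l = rightEnd (view l)

  linkRight-inject₁ : ∀ l a → linkRight (inject₁ l) a ≡ lift l (stubEnd (input a))
  linkRight-inject₁ l a rewrite view-inject₁ l = refl

  linkRight-fromℕ : ∀ a → linkRight (fromℕ n) a ≡ (apex , a)
  linkRight-fromℕ a rewrite view-fromℕ n = refl

  -- An edge with a chosen end is sent to the vertex there and the slot it occupies. The inverse is
  -- `half`, and this bijection yields the numbering of the edges at each vertex.
  dart : Edge n → Bool → Vertex n × Fin 3
  dart (side a) false   = corner (next a) , 1F
  dart (side a) true    = corner (prev a) , 2F
  dart (link l a) false = linkLeft l a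
  dart (link l a) true  = linkRight l a
  dart (within l e) s   = lift l (stubEnd (inner e s))

  halfEdge : Fin n → Stub → Edge n × Bool
  halfEdge l (input a)   = link (inject₁ l) a , true
  halfEdge l (output a)  = link (suc l) a , false
  halfEdge l (inner e s) = within l e , s

  half : Vertex n × Fin 3 → Edge n × Bool
  half (corner a , 0F) = link zero a , false
  half (corner a , 1F) = side (prev a) , false
  half (corner a , 2F) = side (next a) , true
  half (apex , a)      = link (fromℕ n) a , true
  half (at l v , a)    = halfEdge l (levelStub v a)

  dart-halfEdge : ∀ l s → dart (proj₁ (halfEdge l s)) (proj₂ (halfEdge l s)) ≡ lift l (stubEnd s)
  dart-halfEdge l (input a)   = linkRight-inject₁ l a
  dart-halfEdge l (output a)  = refl
  dart-halfEdge l (inner e s) = refl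

  half-lift : ∀ l s → half (lift l (stubEnd s)) ≡ halfEdge l s
  half-lift l s = cong (halfEdge l) (levelStub-stubEnd s)

  dart-half : ∀ v a → dart (proj₁ (half (v , a))) (proj₂ (half (v , a))) ≡ (v , a)
  dart-half (corner a) 0F  = refl
  dart-half (corner 0F) 1F = refl
  dart-half (corner 1F) 1F = refl
  dart-half (corner 2F) 1F = refl
  dart-half (corner 0F) 2F = refl
  dart-half (corner 1F) 2F = refl
  dart-half (corner 2F) 2F = refl
  dart-half apex a         = linkRight-fromℕ a
  dart-half (at l v) a     = trans (dart-halfEdge l (levelStub v a)) (cong (lift l) (stubEnd-levelStub v a))

  half-dart : ∀ e s → half (dart e s) ≡ (e , s)
  half-dart (side 0F) false = refl
  half-dart (side 1F) false = refl
  half-dart (side 2F) false = refl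
  half-dart (side 0F) true  = refl
  half-dart (side 1F) true  = refl
  half-dart (side 2F) true  = refl
  half-dart (link zero a) false = refl
  half-dart (link (suc l) a) false = half-lift l (output a)
  half-dart (link l a) true with view l
  ... | ‵fromℕ     = refl
  ... | ‵inject₁ i = half-lift i (input a)
  half-dart (within l e) s = half-lift l (inner e s)

  -- A link starts at a corner or an exit and ends at the apex, a terminal or a middle vertex, so
  -- its ends differ in kind, however `l` and `m` are related.
  link-loopless : ∀ l {m} (w : View m) a → proj₁ (linkLeft l a) ≢ proj₁ (rightEnd w a)
  link-loopless zero    ‵fromℕ       a  ()
  link-loopless (suc l) ‵fromℕ       a  ()
  link-loopless zero    (‵inject₁ i) a  ()
  link-loopless (suc l) (‵inject₁ i) 0F ()
  link-loopless (suc l) (‵inject₁ i) 1F ()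
  link-loopless (suc l) (‵inject₁ i) 2F ()

  dart-loopless : ∀ e → proj₁ (dart e false) ≢ proj₁ (dart e true)
  dart-loopless (side 0F) ()
  dart-loopless (side 1F) ()
  dart-loopless (side 2F) ()
  dart-loopless (link l a) eq = link-loopless l (view l) a eq
  dart-loopless (within l e) eq = inner-loopless e (at-injective eq)
    where
    at-injective : ∀ {l v w} → _≡_ {A = Vertex n} (at l v) (at l w) → v ≡ w
    at-injective refl = refl

chain : ℕ → Graph
chain n = record
  { V        = Vertex n
  ; E        = Edge n
  ; V-finite = Fin-finite 3 ⊎-finite Fin-finite 1 ⊎-finite (Fin-finite n ×-finite levelVertex-finite)
  ; E-finite = Fin-finite 3 ⊎-finite (Fin-finite (suc n) ×-finite Fin-finite 3)
                 ⊎-finite (Fin-finite n ×-finite levelEdge-finite)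
  ; ends     = λ e → proj₁ (dart e false) , proj₁ (dart e true)
  ; loopless = dart-loopless
  }

slots : ∀ n → Slots (chain n)
slots n = record
  { inc           = λ v a → proj₁ (half (v , a))
  ; inc-injective = λ v {a} {b} → injective (dart-half v a) (dart-half v b)
  ; incident      = λ v a → incident′ (proj₁ (half (v , a))) (proj₂ (half (v , a))) (sym (cong proj₁ (dart-half v a)))
  ; slot          = λ { {e = e} (inj₁ refl) → proj₂ (dart e false) , cong proj₁ (half-dart e false)
                      ; {e = e} (inj₂ refl) → proj₂ (dart e true) , cong proj₁ (half-dart e true) }
  }
  where
  incident′ : ∀ {v} e s → v ≡ proj₁ (dart e s) → Incident (chain n) v e
  incident′ e false eq = inj₁ eq
  incident′ e true  eq = inj₂ eq

  -- The same edge at the same end occupies one slot only; at opposite ends it would be a loop.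
  injective : ∀ {v a b e f s t} → dart {n} e s ≡ (v , a) → dart f t ≡ (v , b) → e ≡ f → a ≡ b
  injective {s = false} {t = false} p q refl = ,-injectiveʳ (trans (sym p) q)
  injective {s = true}  {t = true}  p q refl = ,-injectiveʳ (trans (sym p) q)
  injective {e = e} {s = false} {t = true}  p q refl =
    ⊥-elim (dart-loopless e (trans (cong proj₁ p) (sym (cong proj₁ q))))
  injective {e = e} {s = true}  {t = false} p q refl =
    ⊥-elim (dart-loopless e (trans (cong proj₁ q) (sym (cong proj₁ p))))

-- The lower bound

-- The Booleans are the values on the edges leaving the gadget, and `m` counts the chosen ones among
-- three alternate edges of its hexagon. In the full case `m` may be 0 or 3, so no parity is
-- recorded there.
data Gadget : Bool → Bool → Bool → ℕ → Set where
  single : ∀ {a b c m} → One a b c → 2 ∣ m → Gadget a b c m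
  triple : ∀ {m} → Gadget true true true m

-- The six single cases are the perfect matchings of the Petersen graph.
gadget-type :
  ∀ {d₀ d₁ d₂ s₀ s₀′ s₁ s₁′ s₂ s₂′ r₀ r₀′ r₁ r₁′ r₂ r₂′} →
  One d₀ s₀ s₀′ → One d₁ s₁ s₁′ → One d₂ s₂ s₂′ →
  One s₀ r₀ r₀′ → One s₀′ r₂ r₁′ → One s₁ r₁ r₁′ → One s₁′ r₀ r₂′ → One s₂ r₂ r₂′ → One s₂′ r₁ r₀′ →
  Gadget d₀ d₁ d₂ (sum₃ r₀ r₁ r₂)
gadget-type first first first second second second second second second = triple
gadget-type first first first third third third third third third = triple
gadget-type first second third second second first second second first = single first (divides 1 refl)
gadget-type third first second second first second second first second = single second (divides 1 refl)
gadget-type second third first first second second first second second = single third (divides 1 refl)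
gadget-type first third second third third third first first third = single first (divides 0 refl)
gadget-type second first third first third third third third first = single second (divides 0 refl)
gadget-type third second first third first first third third third = single third (divides 0 refl)
gadget-type first first third second third third second () first

∧₃ : Bool → Bool → Bool → Bool
∧₃ a b c = a ∧ b ∧ c

gadget-sum : ∀ {a b c m} → Gadget a b c m → sum₃ a b c ≡ 1 + 2 * ⟦ ∧₃ a b c ⟧
gadget-sum (single first _)  = refl
gadget-sum (single second _) = refl
gadget-sum (single third _)  = refl
gadget-sum triple            = refl

gadget-even : ∀ {a b c m} → Gadget a b c m → ∧₃ a b c ≡ false → 2 ∣ m
gadget-even (single _ even) _ = even

some-triple :
  ∀ {k t} {a b c r₀ r₁ r₂ : Fin k → Bool} {a′ b′ c′ r₀′ r₁′ r₂′ : Fin t → Bool} → t ≡ 3 + k →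
  (∀ i → Gadget (a i) (b i) (c i) (sum₃ (r₀ i) (r₁ i) (r₂ i))) →
  (∀ j → Gadget (a′ j) (b′ j) (c′ j) (sum₃ (r₀′ j) (r₁′ j) (r₂′ j))) →
  # a′ ≡ suc (# a) → # b′ ≡ suc (# b) → # c′ ≡ suc (# c) →
  # r₀′ ≡ suc (# r₀) → # r₁′ ≡ suc (# r₁) → # r₂′ ≡ suc (# r₂) →
  ¬ (∀ i → ∧₃ (a i) (b i) (c i) ≡ false)
some-triple {k} {t} {a} {b} {c} {r₀} {r₁} {r₂} {a′} {b′} {c′} {r₀′} {r₁′} {r₂′}
            t≡3+k G G′ #a #b #c #r₀ #r₁ #r₂ none =
  contradiction 2∣3 (from-no (2 ∣? 3))
  where
  open ≡-Reasoning

  τ : Fin k → Bool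
  τ i = ∧₃ (a i) (b i) (c i)

  τ′ : Fin t → Bool
  τ′ j = ∧₃ (a′ j) (b′ j) (c′ j)

  pull : ∀ x y z → suc x + suc y + suc z ≡ x + y + z + 3
  pull = solve-∀

  #τ : # τ ≡ 0
  #τ = trans (sum-cong-≗ (λ i → cong ⟦_⟧ (none i))) (trans (sum-const k) (*-zeroʳ k))

  -- The `M i` use the leaving edges `k` times in all, so the `N j` use them `k + 3 = t` times,
  -- which leaves no surplus over one for each `j`.
  #τ′ : # τ′ ≡ 0
  #τ′ = *-cancelˡ-≡ (# τ′) 0 2 (+-cancelˡ-≡ t (2 * # τ′) 0 (begin
    t + 2 * # τ′
      ≡⟨ sum₃-sum (λ j → gadget-sum (G′ j)) ⟨
    # a′ + # b′ + # c′
      ≡⟨ cong₂ _+_ (cong₂ _+_ #a #b) #c ⟩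
    suc (# a) + suc (# b) + suc (# c)
      ≡⟨ pull (# a) (# b) (# c) ⟩
    # a + # b + # c + 3
      ≡⟨ cong (_+ 3) (sum₃-sum (λ i → gadget-sum (G i))) ⟩
    k + 2 * # τ + 3
      ≡⟨ cong (λ m → k + 2 * m + 3) #τ ⟩
    k + 0 + 3
      ≡⟨ regroup k ⟩
    3 + k + 0
      ≡⟨ cong (_+ 0) t≡3+k ⟨
    t + 0 ∎))
    where
    regroup : ∀ k → k + 0 + 3 ≡ 3 + k + 0
    regroup = solve-∀

  2∣r : 2 ∣ # r₀ + # r₁ + # r₂
  2∣r = sum₃-even r₀ r₁ r₂ λ i → gadget-even (G i) (none i)

  2∣r′ : 2 ∣ # r₀′ + # r₁′ + # r₂′
  2∣r′ = sum₃-even r₀′ r₁′ r₂′ λ j → gadget-even (G′ j) (#-zero τ′ #τ′ j)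

  -- Each of the three alternate edges is used once more by the `N j` than by the `M i`, so two even
  -- totals differ by 3.
  2∣3 : 2 ∣ 3
  2∣3 = ∣m+n∣m⇒∣n (subst (2 ∣_)
    (trans (cong₂ _+_ (cong₂ _+_ #r₀ #r₁) #r₂) (pull (# r₀) (# r₁) (# r₂))) 2∣r′) 2∣r

-- The edges of the six-cycle are counted at its x's and at its y's.
level-flow :
  ∀ {i₀ i₁ i₂ o₀ o₁ o₂ c₀ c₀′ c₁ c₁′ c₂ c₂′ m} →
  Gadget i₀ c₂ c₁′ m → One i₁ c₀ c₂′ → One i₂ c₁ c₀′ →
  One o₀ c₀ c₀′ → One o₁ c₁ c₁′ → One o₂ c₂ c₂′ →
  sum₃ i₀ i₁ i₂ ≡ sum₃ o₀ o₁ o₂ + 2 * ⟦ ∧₃ i₀ c₂ c₁′ ⟧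
level-flow {i₀} {i₁} {i₂} {o₀} {o₁} {o₂} {c₀} {c₀′} {c₁} {c₁′} {c₂} {c₂′} G x₁ x₂ y₀ y₁ y₂ =
  +-cancelʳ-≡ C (sum₃ i₀ i₁ i₂) (sum₃ o₀ o₁ o₂ + 2 * τ) (begin
    sum₃ i₀ i₁ i₂ + C
      ≡⟨ inputs ⟦ i₀ ⟧ ⟦ i₁ ⟧ ⟦ i₂ ⟧ ⟦ c₀ ⟧ ⟦ c₀′ ⟧ ⟦ c₁ ⟧ ⟦ c₁′ ⟧ ⟦ c₂ ⟧ ⟦ c₂′ ⟧ ⟩
    sum₃ i₀ c₂ c₁′ + sum₃ i₁ c₀ c₂′ + sum₃ i₂ c₁ c₀′
      ≡⟨ cong₂ _+_ (cong₂ _+_ (gadget-sum G) (one-sum x₁)) (one-sum x₂) ⟩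
    1 + 2 * τ + 1 + 1
      ≡⟨ regroup (2 * τ) ⟩
    1 + 1 + 1 + 2 * τ
      ≡⟨ cong (_+ 2 * τ) (cong₂ _+_ (cong₂ _+_ (one-sum y₀) (one-sum y₁)) (one-sum y₂)) ⟨
    sum₃ o₀ c₀ c₀′ + sum₃ o₁ c₁ c₁′ + sum₃ o₂ c₂ c₂′ + 2 * τ
      ≡⟨ outputs ⟦ o₀ ⟧ ⟦ o₁ ⟧ ⟦ o₂ ⟧ ⟦ c₀ ⟧ ⟦ c₀′ ⟧ ⟦ c₁ ⟧ ⟦ c₁′ ⟧ ⟦ c₂ ⟧ ⟦ c₂′ ⟧ (2 * τ) ⟩
    sum₃ o₀ o₁ o₂ + 2 * τ + C ∎)
  where
  open ≡-Reasoning
  τ = ⟦ ∧₃ i₀ c₂ c₁′ ⟧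
  C = ⟦ c₀ ⟧ + ⟦ c₀′ ⟧ + ⟦ c₁ ⟧ + ⟦ c₁′ ⟧ + ⟦ c₂ ⟧ + ⟦ c₂′ ⟧
  inputs : ∀ i j k a a′ b b′ c c′ → i + j + k + (a + a′ + b + b′ + c + c′)
                                  ≡ i + c + b′ + (j + a + c′) + (k + b + a′)
  inputs = solve-∀
  regroup : ∀ t → 1 + t + 1 + 1 ≡ 1 + 1 + 1 + t
  regroup = solve-∀
  outputs : ∀ i j k a a′ b b′ c c′ t → i + a + a′ + (j + b + b′) + (k + c + c′) + t
                                     ≡ i + j + k + t + (a + a′ + b + b′ + c + c′)
  outputs = solve-∀

¬T⇒≡false : ∀ {b} → ¬ T b → b ≡ false
¬T⇒≡false {true}  ¬t = ⊥-elim (¬t tt)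
¬T⇒≡false {false} ¬t = refl

module _ {n : ℕ} where

  private
    S : Slots (chain n)
    S = slots n

  -- The edges at slot 0 of the three terminals, which are those leaving the gadget.
  full : EdgeSet (chain n) → Fin n → Bool
  full F l = ∧₃ (F (link (inject₁ l) 0F)) (F (within l (cross 2F false))) (F (within l (cross 1F true)))

  rims : EdgeSet (chain n) → Fin n → ℕ
  rims F l = sum₃ (F (within l (rim 0F false))) (F (within l (rim 1F false))) (F (within l (rim 2F false)))

  module _ (F : EdgeSet (chain n)) (one : ∀ v → OneAt S F v) where

    gadget : ∀ l → Gadget (F (link (inject₁ l) 0F)) (F (within l (cross 2F false)))
                          (F (within l (cross 1F true))) (rims F l)
    gadget l = gadget-type
      (one (at l (terminal 0F))) (one (at l (terminal 1F))) (one (at l (terminal 2F)))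
      (one (at l (hexagon 0F false))) (one (at l (hexagon 0F true)))
      (one (at l (hexagon 1F false))) (one (at l (hexagon 1F true)))
      (one (at l (hexagon 2F false))) (one (at l (hexagon 2F true)))

    full-unique : ∀ {l m} → T (full F l) → T (full F m) → l ≡ m
    -- At most 3 links leave the triangle and exactly 1 reaches the apex, so at most one loss of 2
    -- fits in between.
    full-unique = #-unique (full F) (*-cancelˡ-≤ {# full F} {1} 2 (+-cancelˡ-≤ 1 (2 * # full F) 2 (begin
      1 + 2 * # full F           ≡⟨ cong (_+ 2 * # full F) (one-sum (one apex)) ⟨
      L (fromℕ n) + 2 * # full F ≡⟨ telescope L (⟦_⟧ ∘ full F) flow ⟨
      L zero                     ≤⟨ sum₃≤3 (F (link zero 0F)) (F (link zero 1F)) (F (link zero 2F)) ⟩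
      3                          ∎)))
      where
      open ≤-Reasoning
      L : Fin (suc n) → ℕ
      L l = sum₃ (F (link l 0F)) (F (link l 1F)) (F (link l 2F))
      flow : ∀ l → L (inject₁ l) ≡ L (suc l) + 2 * ⟦ full F l ⟧
      flow l = level-flow (gadget l)
        (one (at l (middle false))) (one (at l (middle true)))
        (one (at l (exit 0F))) (one (at l (exit 1F))) (one (at l (exit 2F)))

  module _ {k t} (t≡3+k : t ≡ 3 + k) (M : Fin k → EdgeSet (chain n)) (N : Fin t → EdgeSet (chain n))
           (M-one : ∀ i v → OneAt S (M i) v) (N-one : ∀ j v → OneAt S (N j) v)
           (count : ∀ e → # (λ j → N j e) ≡ suc (# λ i → M i e)) where

    -- The search over `i` is finite, so refuting that no `M i` is full at `l` produces a witness.
    some-full : ∀ l → ∃ λ i → T (full (M i) l)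
    some-full l = decidable-stable (any? λ i → T? (full (M i) l)) λ none →
      some-triple t≡3+k (λ i → gadget (M i) (M-one i) l) (λ j → gadget (N j) (N-one j) l)
        (count (link (inject₁ l) 0F)) (count (within l (cross 2F false))) (count (within l (cross 1F true)))
        (count (within l (rim 0F false))) (count (within l (rim 1F false))) (count (within l (rim 2F false)))
        λ i → ¬T⇒≡false λ t → none (i , t)

    -- Sending each level to a matching full there is injective, because a matching is full at most
    -- once.
    matchings≥ : n ≤ k
    matchings≥ = injective⇒≤ {f = λ l → proj₁ (some-full l)} λ {l} {m} eq →
      let i = proj₁ (some-full l)
      in full-unique (M i) (M-one i) {l} {m} (proj₂ (some-full l))
           (subst (λ i → T (full (M i) m)) (sym eq) (proj₂ (some-full m)))

  lower-bound : ∀ k → ClassIAfterAdding (chain n) k → n ≤ k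
  lower-bound k (M , perfect , classI) =
    let N , N-one , count = classI⇒matchings S M perfect apex classI
    in matchings≥ refl M N (λ i → perfect⇒one S (perfect i)) N-one count

-- The upper bound

_==_ : Fin 3 → Fin 3 → Bool
a == b = ⌊ a ≟ꟳ b ⌋

-- On the six-cycle, `x_a` and `y_a` are left to the links, and the other vertices are paired as
-- `y_{a+1} x_{a+2}` and `y_{a+2} x_{a+1}`. In each case the gadget is left through terminal `a`
-- only.
usualValue : Fin 3 → LevelEdge → Bool
usualValue a (spoke b false) = next a == b
usualValue a (spoke b true)  = prev a == b
usualValue a (rim b false)   = not (next a == b)
usualValue a (rim b true)    = false
usualValue a (cross b false) = next a == b
usualValue a (cross b true)  = prev a == b

-- In `switch p` the gadget is full and its hexagon is matched by the alternate triple `p`. In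
-- `pass` the links alone cover the six-cycle, and the gadget is left through its incoming link as
-- in `usual 0F`.
innerValue : State → LevelEdge → Bool
innerValue (usual a)  e               = usualValue a e
innerValue (switch p) (spoke b q)     = false
innerValue (switch p) (rim b q)       = ⌊ p ≟ᵇ q ⌋
innerValue (switch p) (cross b false) = 2F == b
innerValue (switch p) (cross b true)  = 1F == b
innerValue pass       (spoke b q)     = usualValue 0F (spoke b q)
innerValue pass       (rim b q)       = usualValue 0F (rim b q)
innerValue pass       (cross b q)     = false

stateValue : State → Stub → Bool
stateValue σ          (inner e _) = innerValue σ e
stateValue (usual a)  (input b)   = a == b
stateValue (usual a)  (output b)  = a == b
stateValue (switch p) (input b)   = true
stateValue (switch p) (output b)  = 0F == b
stateValue pass       (input b)   = true
stateValue pass       (output b)  = true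

stateValue-one : ∀ σ v → One (stateValue σ (levelStub v 0F)) (stateValue σ (levelStub v 1F))
                             (stateValue σ (levelStub v 2F))
stateValue-one = from-yes (finite-all? state-finite λ σ → finite-all? levelVertex-finite λ v →
  one? (stateValue σ (levelStub v 0F)) (stateValue σ (levelStub v 1F)) (stateValue σ (levelStub v 2F)))

levelValue : State → LevelEdge → ℕ
levelValue σ e = ⟦ innerValue σ e ⟧

-- Together the three usual states contain every edge off the hexagon once, but the rims `false`
-- twice and the rims `true` never. Trading `switch false` for `switch true` repairs this.
level-balance : ∀ e → levelValue (usual 0F) e + (levelValue (usual 1F) e
                        + (levelValue (usual 2F) e + levelValue (switch true) e))
                    ≡ suc (levelValue (switch false) e)
level-balance = from-yes (finite-all? levelEdge-finite λ e →
  levelValue (usual 0F) e + (levelValue (usual 1F) e + (levelValue (usual 2F) e + levelValue (switch true) e))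
    ≟ suc (levelValue (switch false) e))

#-swap : ∀ {n} {f g : Fin n → Bool} l → (∀ i → i ≢ l → f i ≡ g i) → # f + ⟦ g l ⟧ ≡ # g + ⟦ f l ⟧
#-swap {suc n} {f} {g} zero    agree = begin
  ⟦ f zero ⟧ + # (f ∘ suc) + ⟦ g zero ⟧
    ≡⟨ cong (λ m → ⟦ f zero ⟧ + m + ⟦ g zero ⟧) (sum-cong-≗ λ i → cong ⟦_⟧ (agree (suc i) λ ())) ⟩
  ⟦ f zero ⟧ + # (g ∘ suc) + ⟦ g zero ⟧
    ≡⟨ exchange ⟦ f zero ⟧ (# (g ∘ suc)) ⟦ g zero ⟧ ⟩
  ⟦ g zero ⟧ + # (g ∘ suc) + ⟦ f zero ⟧ ∎
  where
  open ≡-Reasoning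
  exchange : ∀ a b c → a + b + c ≡ c + b + a
  exchange = solve-∀
#-swap {suc n} {f} {g} (suc l) agree = begin
  ⟦ f zero ⟧ + # (f ∘ suc) + ⟦ g (suc l) ⟧
    ≡⟨ +-assoc ⟦ f zero ⟧ (# (f ∘ suc)) ⟦ g (suc l) ⟧ ⟩
  ⟦ f zero ⟧ + (# (f ∘ suc) + ⟦ g (suc l) ⟧)
    ≡⟨ cong₂ _+_ (cong ⟦_⟧ (agree zero λ ())) (#-swap l λ i i≢l → agree (suc i) (i≢l ∘ Fin.suc-injective)) ⟩
  ⟦ g zero ⟧ + (# (g ∘ suc) + ⟦ f (suc l) ⟧)
    ≡⟨ +-assoc ⟦ g zero ⟧ (# (g ∘ suc)) ⟦ f (suc l) ⟧ ⟨
  ⟦ g zero ⟧ + # (g ∘ suc) + ⟦ f (suc l) ⟧ ∎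
  where open ≡-Reasoning

-- The matching full at level `i` carries all three links through the earlier levels, loses two at
-- `i`, and keeps link 0 from there to the apex. Only the state at level `i` depends on `p`.
switchState : ∀ {n} → Bool → Fin n → Fin n → State
switchState p zero    zero    = switch p
switchState p (suc i) zero    = pass
switchState p zero    (suc l) = usual 0F
switchState p (suc i) (suc l) = switchState p i l

switchLink : ∀ {n} → Fin n → Fin (suc n) → Fin 3 → Bool
switchLink i       zero    a = true
switchLink zero    (suc l) a = 0F == a
switchLink (suc i) (suc l) a = switchLink i l a

switchLink-input : ∀ {n} p (i l : Fin n) a → switchLink i (inject₁ l) a ≡ stateValue (switchState p i l) (input a)
switchLink-input p zero    zero    a = refl
switchLink-input p (suc i) zero    a = refl
switchLink-input p zero    (suc l) a = refl
switchLink-input p (suc i) (suc l) a = switchLink-input p i l a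

switchLink-output : ∀ {n} p (i l : Fin n) a → switchLink i (suc l) a ≡ stateValue (switchState p i l) (output a)
switchLink-output p zero    zero    a = refl
switchLink-output p (suc i) zero    a = refl
switchLink-output p zero    (suc l) a = refl
switchLink-output p (suc i) (suc l) a = switchLink-output p i l a

switchLink-last : ∀ {n} (i : Fin n) a → switchLink i (fromℕ n) a ≡ (0F == a)
switchLink-last zero    a = refl
switchLink-last (suc i) a = switchLink-last i a

switchState-at : ∀ {n} p (l : Fin n) → switchState p l l ≡ switch p
switchState-at p zero    = refl
switchState-at p (suc l) = switchState-at p l

switchState-off : ∀ {n} {p q} (i l : Fin n) → i ≢ l → switchState p i l ≡ switchState q i l
switchState-off zero    zero    i≢l = contradiction refl i≢l
switchState-off (suc i) zero    i≢l = refl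
switchState-off zero    (suc l) i≢l = refl
switchState-off (suc i) (suc l) i≢l = switchState-off i l (i≢l ∘ cong suc)

one-resp : ∀ {a b c a′ b′ c′} → a ≡ a′ → b ≡ b′ → c ≡ c′ → One a′ b′ c′ → One a b c
one-resp refl refl refl o = o

≟-one : ∀ a → One (a == 0F) (a == 1F) (a == 2F)
≟-one 0F = first
≟-one 1F = second
≟-one 2F = third

-- Matchings of the whole chain

module _ {n : ℕ} where

  private
    S : Slots (chain n)
    S = slots n

  assemble : (Fin 3 → Bool) → (Fin (suc n) → Fin 3 → Bool) → (Fin n → State) → EdgeSet (chain n)
  assemble sides links σ (side a)     = sides a
  assemble sides links σ (link l a)   = links l a
  assemble sides links σ (within l e) = innerValue (σ l) e

  -- Inside a level, `stateValue-one` has settled each state. It remains that the links agree with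
  -- the states on either side and that the triangle and the apex are matched.
  assemble-one : ∀ {sides links σ} →
    (∀ a → One (links zero a) (sides (prev a)) (sides (next a))) →
    (∀ l a → links (inject₁ l) a ≡ stateValue (σ l) (input a)) →
    (∀ l a → links (suc l) a ≡ stateValue (σ l) (output a)) →
    One (links (fromℕ n) 0F) (links (fromℕ n) 1F) (links (fromℕ n) 2F) →
    ∀ v → OneAt S (assemble sides links σ) v
  assemble-one corners ins outs end (corner a) = corners a
  assemble-one corners ins outs end apex       = end
  assemble-one {sides} {links} {σ} corners ins outs end (at l v) =
    one-resp (value (levelStub v 0F)) (value (levelStub v 1F)) (value (levelStub v 2F)) (stateValue-one (σ l) v)
    where
    value : ∀ s → assemble sides links σ (proj₁ (halfEdge l s)) ≡ stateValue (σ l) s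
    value (input a)   = ins l a
    value (output a)  = outs l a
    value (inner e s) = refl

  usualMatching : Fin 3 → EdgeSet (chain n)
  usualMatching a = assemble (a ==_) (λ _ → a ==_) (λ _ → usual a)

  usualMatching-one : ∀ a v → OneAt S (usualMatching a) v
  usualMatching-one a = assemble-one (corners a) (λ _ _ → refl) (λ _ _ → refl) (≟-one a)
    where
    corners : ∀ a b → One (a == b) (a == prev b) (a == next b)
    corners = from-yes (all? λ a → all? λ b → one? (a == b) (a == prev b) (a == next b))

  switchMatching : Bool → Fin n → EdgeSet (chain n)
  switchMatching p i = assemble (λ _ → false) (switchLink i) (switchState p i)

  switchMatching-one : ∀ p i v → OneAt S (switchMatching p i) v
  switchMatching-one p i = assemble-one (λ _ → first) (switchLink-input p i) (switchLink-output p i)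
    (one-resp (switchLink-last i 0F) (switchLink-last i 1F) (switchLink-last i 2F) first)

  colourClass : Fin (3 + n) → EdgeSet (chain n)
  colourClass 0F                  = usualMatching 0F
  colourClass 1F                  = usualMatching 1F
  colourClass 2F                  = usualMatching 2F
  colourClass (suc (suc (suc i))) = switchMatching true i

  colourClass-one : ∀ j v → OneAt S (colourClass j) v
  colourClass-one 0F                  = usualMatching-one 0F
  colourClass-one 1F                  = usualMatching-one 1F
  colourClass-one 2F                  = usualMatching-one 2F
  colourClass-one (suc (suc (suc i))) = switchMatching-one true i

  colourClass-count : ∀ e → # (λ j → colourClass j e) ≡ suc (# λ i → switchMatching false i e)
  -- On sides and links the two families of switch matchings agree by computation, and exactly one
  -- usual matching contains the edge.
  colourClass-count (side 0F)    = refl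
  colourClass-count (side 1F)    = refl
  colourClass-count (side 2F)    = refl
  colourClass-count (link l 0F)  = refl
  colourClass-count (link l 1F)  = refl
  colourClass-count (link l 2F)  = refl
  -- Adding the value of `switch false` to both sides allows the exchange of `f` for `g` without
  -- subtraction.
  colourClass-count (within l e) = +-cancelʳ-≡ (levelValue (switch false) e) _ _ (begin
    a + (b + (c + f)) + levelValue (switch false) e
      ≡⟨ gather a b c f (levelValue (switch false) e) ⟩
    a + (b + (c + (f + levelValue (switch false) e)))
      ≡⟨ cong (λ m → a + (b + (c + m))) exchanged ⟩
    a + (b + (c + (g + levelValue (switch true) e)))
      ≡⟨ regroup a b c g (levelValue (switch true) e) ⟩
    a + (b + (c + levelValue (switch true) e)) + g
      ≡⟨ cong (_+ g) (level-balance e) ⟩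
    suc (levelValue (switch false) e) + g
      ≡⟨ cong suc (+-comm (levelValue (switch false) e) g) ⟩
    suc g + levelValue (switch false) e ∎)
    where
    open ≡-Reasoning
    a = levelValue (usual 0F) e
    b = levelValue (usual 1F) e
    c = levelValue (usual 2F) e
    f = # λ i → switchMatching true i (within l e)
    g = # λ i → switchMatching false i (within l e)
    exchanged : f + levelValue (switch false) e ≡ g + levelValue (switch true) e
    -- On level `l` the two families differ only in their members with index `l`, whose states there
    -- are `switch true` and `switch false`.
    exchanged = subst₂ (λ σ τ → f + levelValue σ e ≡ g + levelValue τ e)
      (switchState-at false l) (switchState-at true l)
      (#-swap l λ i i≢l → cong (λ σ → innerValue σ e) (switchState-off i l i≢l))
    gather : ∀ a b c f x → a + (b + (c + f)) + x ≡ a + (b + (c + (f + x)))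
    gather = solve-∀
    regroup : ∀ a b c g x → a + (b + (c + (g + x))) ≡ a + (b + (c + x)) + g
    regroup = solve-∀

  upper-bound : ClassIAfterAdding (chain n) n
  upper-bound = switchMatching false , perfect , matchings⇒classI S (switchMatching false) perfect apex colourClass
      (λ j → one⇒perfect S (colourClass-one j)) colourClass-count
    where
    perfect : ∀ i → IsPerfectMatching (chain n) (switchMatching false i)
    perfect i = one⇒perfect S (switchMatching-one false i)

corollary3p9 : (n : ℕ) → n ≥ 1 → ∃ λ (H : Graph) → Cubic H × l[ H ]≡ [ n ]
corollary3p9 n _ = chain n , cubic (slots n) , upper-bound , lower-bound
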